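{- Let $\mathcal{U}$ be a universe. Then $\mathcal{U}$ has the conjugate property: for every $G\in\mathcal{U}$, if there exists $H\in\mathcal{U}$ with $G+H\equiv_{\mathcal{U}}0$, then $\overline{G}\in\mathcal{U}$ and $G+\overline{G}\equiv_{\mathcal{U}}0$.
   Context: All games are short partizan game forms $G=\{G^L\mid G^R\}$ played under the misère convention (a player unable to move on their turn wins). $\overline{G}$ denotes the conjugate of $G$ (roles of Left and Right swapped recursively); $+$ is the disjunctive sum. The outcome $o(G)\in\{\mathscr{L},\mathscr{N},\mathscr{P},\mathscr{R}\}$ is ordered by $\mathscr{L}>\mathscr{N}>\mathscr{R}$, $\mathscr{L}>\mathscr{P}>\mathscr{R}$ ($\mathscr{N},\mathscr{P}$ incomparable). For a set of games $\mathcal{A}$, $G\geq_{\mathcal{A}}H$ means $o(G+X)\geq o(H+X)$ for all $X\in\mathcal{A}$, and $G\equiv_{\mathcal{A}}H$ means $G\geq_{\mathcal{A}}H$ and $H\geq_{\mathcal{A}}G$. A universe is a set $\mathcal{U}$ of games such that for all $G,H\in\mathcal{U}$: $G+H\in\mathcal{U}$; $\overline{G}\in\mathcal{U}$; every option of $G$ is in $\mathcal{U}$; and whenever $\mathscr{G},\mathscr{H}\subseteq\mathcal{U}$ are finite and non-empty, $\{\mathscr{G}\mid\mathscr{H}\}\in\mathcal{U}$. A game $G\in\mathcal{U}$ is $\mathcal{U}$-invertible if some $H\in\mathcal{U}$ satisfies $G+H\equiv_{\mathcal{U}}0$, and conjugate $\mathcal{U}$-invertible if $\overline{G}\in\mathcal{U}$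 and $G+\overline{G}\equiv_{\mathcal{U}}0$; $\mathcal{U}$ has the conjugate property if these two notions coincide on $\mathcal{U}$. -}

module Defs where

open import Data.Nat using (ℕ; zero; suc; _+_)
open import Data.Fin using (Fin; splitAt)
import Data.Fin as F
open import Data.Bool using (Bool; true; false; not; _∨_)
open import Data.Sum using (_⊎_; inj₁; inj₂; [_,_])
open import Data.Product using (Σ; _×_)
open import Level using (Level)
import Level

-- Short partizan game forms: finitely many Left options and finitely many
-- Right options, given as finite families.
data Game : Set where
  mk : (nL : ℕ) → (Fin nL → Game) → (nR : ℕ) → (Fin nR → Game) → Game

0G : Game
0G = mk 0 (λ ()) 0 (λ ())

conj : Game → Game
conj (mk nL L nR R) = mk nR (λ i → conj (R i)) nL (λ i → conj (L i))

infixl 6 _⊕_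
_⊕_ : Game → Game → Game
mk nL L nR R ⊕ mk mL L' mR R' =
  mk (nL + mL)
     (λ i → [ (λ a → L a ⊕ mk mL L' mR R') , (λ b → mk nL L nR R ⊕ L' b) ] (splitAt nL i))
     (nR + mR)
     (λ i → [ (λ a → R a ⊕ mk mL L' mR R') , (λ b → mk nL L nR R ⊕ R' b) ] (splitAt nR i))

anyFin : (n : ℕ) → (Fin n → Bool) → Bool
anyFin zero    f = false
anyFin (suc n) f = f F.zero ∨ anyFin n (λ i → f (F.suc i))

-- Misère play: a player unable to move on their turn wins.
-- leftWinsFirst G  : Left, moving first in G, has a winning strategy.
-- rightWinsFirst G : Right, moving first in G, has a winning strategy.
leftWinsFirst  : Game → Bool
rightWinsFirst : Game → Bool
leftWinsFirst (mk zero L nR R) = true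
leftWinsFirst (mk (suc n) L nR R) = anyFin (suc n) (λ i → not (rightWinsFirst (L i)))
rightWinsFirst (mk nL L zero R) = true
rightWinsFirst (mk nL L (suc n) R) = anyFin (suc n) (λ i → not (leftWinsFirst (R i)))

data Outcome : Set where
  𝓛 𝓝 𝓟 𝓡 : Outcome

outcomeOf : Bool → Bool → Outcome
outcomeOf true  false = 𝓛
outcomeOf true  true  = 𝓝
outcomeOf false false = 𝓟
outcomeOf false true  = 𝓡

o : Game → Outcome
o G = outcomeOf (leftWinsFirst G) (rightWinsFirst G)

data _≥o_ : Outcome → Outcome → Set where
  refl≥ : ∀ {x} → x ≥o x
  L≥N : 𝓛 ≥o 𝓝
  L≥P : 𝓛 ≥o 𝓟
  L≥R : 𝓛 ≥o 𝓡
  N≥R : 𝓝 ≥o 𝓡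
  P≥R : 𝓟 ≥o 𝓡

GameSet : (ℓ : Level) → Set (Level.suc ℓ)
GameSet ℓ = Game → Set ℓ

_≥[_]_ : {ℓ : Level} → Game → GameSet ℓ → Game → Set ℓ
G ≥[ 𝒜 ] H = ∀ X → 𝒜 X → o (G ⊕ X) ≥o o (H ⊕ X)

_≡[_]_ : {ℓ : Level} → Game → GameSet ℓ → Game → Set ℓ
G ≡[ 𝒜 ] H = (G ≥[ 𝒜 ] H) × (H ≥[ 𝒜 ] G)

-- A universe.  Finite non-empty sets of games are given as families
-- Fin (suc n) → Game (every finite non-empty set arises this way).
record IsUniverse {ℓ : Level} (𝒰 : GameSet ℓ) : Set ℓ where
  field
    sum-closed  : ∀ G H → 𝒰 G → 𝒰 H → 𝒰 (G ⊕ H)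
    conj-closed : ∀ G → 𝒰 G → 𝒰 (conj G)
    leftOpt-closed  : ∀ nL L nR R → 𝒰 (mk nL L nR R) → ∀ i → 𝒰 (L i)
    rightOpt-closed : ∀ nL L nR R → 𝒰 (mk nL L nR R) → ∀ i → 𝒰 (R i)
    build-closed : ∀ m (L : Fin (suc m) → Game) n (R : Fin (suc n) → Game) →
                   (∀ i → 𝒰 (L i)) → (∀ j → 𝒰 (R j)) →
                   𝒰 (mk (suc m) L (suc n) R)

module _ {ℓ : Level} (𝒰 : GameSet ℓ) where

  Invertible : Game → Set ℓ
  Invertible G = 𝒰 G × Σ Game (λ H → 𝒰 H × ((G ⊕ H) ≡[ 𝒰 ] 0G))

  ConjInvertible : Game → Set ℓ
  ConjInvertible G = 𝒰 G × (𝒰 (conj G) × ((G ⊕ conj G) ≡[ 𝒰 ] 0G))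

  -- the two notions coincide on 𝒰 (conjugate-invertible trivially implies
  -- invertible, so the content is the forward direction)
  HasConjugateProperty : Set ℓ
  HasConjugateProperty = ∀ G → 𝒰 G → Invertible G → ConjInvertible G

{-# OPTIONS --safe --termination-depth=2 #-}
module Submission where

-- Let G + H ≡ 0.  In any universe a comparison K ≥ 0 is maintained: each Right
-- option of K has a Left option which is again ≥ 0.  Applied to G + H, this pairs
-- every non-reversible option of H with an option of G, and back, giving chains
-- x + y ≤ 0 ≤ x′ + y, along which x ≤ x′ by pocancellation.  At a maximal x the
-- chain closes up, so x + y ≡ 0, and y ≡ conj x by induction.
-- Reversible options are bypassed unless they reverse through an end; a game is
-- called strong for a player when it is at least as good for them as one of
-- their ends.  If strength matches up suitably, then H and conj G are comparable, so
-- G + conj G is comparable with 0, hence, being its own conjugate, equal to 0.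
-- Otherwise G or H is strong for both players, which suffices to show that its
-- sum with its own conjugate vanishes.

open import Defs
open import Level using (Level; _⊔_)
open import Algebra.Bundles using (CommutativeMonoid)
import Algebra.Solver.CommutativeMonoid as MonoidSolver
open import Data.Bool using (Bool; true; false; not)
import Data.Bool.Properties as Bool
open import Data.Empty using (⊥-elim)
open import Data.Fin using (Fin; splitAt; _↑ˡ_; _↑ʳ_)
import Data.Fin as F
import Data.Vec.Functional as Vector
open import Data.Fin.Properties using (splitAt-↑ˡ; splitAt-↑ʳ)
open import Data.List using (List; []; _∷_; _++_; concat; tabulate)
open import Data.List.Membership.Propositional using (_∈_)
open import Data.List.Membership.Propositional.Properties using (∈-++⁺ˡ; ∈-++⁺ʳ; ∈-concat⁺′; ∈-tabulate⁺)
open import Data.List.Relation.Unary.Any using (here; there)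
open import Data.Nat using (ℕ; zero; suc)
open import Data.Product using (∃; ∃-syntax; _×_; _,_; proj₁; proj₂)
open import Data.Sum using (_⊎_; inj₁; inj₂; [_,_])
open import Function using (_∘_)
open import Induction.WellFounded using (Acc; acc; WellFounded)
open import Relation.Binary.PropositionalEquality using (_≡_; refl; cong)
open import Relation.Nullary using (¬_; Dec; yes; no)
open import Relation.Nullary.Decidable using (decidable-stable; ¬¬-excluded-middle)

private variable
  a b : Level

-- Classical reasoning under double negation

-- The maintenance property is only available classically.  Since outcomes are
-- decidable, everything in between may live under a double negation.
_>>=_ : {A : Set a} {B : Set b} → ¬ ¬ A → (A → ¬ ¬ B) → ¬ ¬ B
(m >>= f) k = m λ x → f x k

return : {A : Set a} → A → ¬ ¬ A
return x k = k x

¬¬-choice : ∀ {n} {P : Fin n → Set a} → (∀ i → ¬ ¬ P i) → ¬ ¬ (∀ i → P i)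
¬¬-choice {n = zero} f = return λ ()
¬¬-choice {n = suc n} f = do
  p ← f F.zero
  ps ← ¬¬-choice (λ i → f (F.suc i))
  return λ { F.zero → p ; (F.suc i) → ps i }

module _ {A : Set} {R : A → A → Set a} {S : A → Set b}
         (R-trans : ∀ {x y z} → R x y → R y z → R x z) where

  Maximal : List A → A → Set (a ⊔ b)
  Maximal l x = S x × (∀ {y} → y ∈ l → S y → R x y → R y x)

  ¬¬-maximal : ∀ l → ¬ ¬ ((∀ {y} → y ∈ l → ¬ S y) ⊎ ∃ (Maximal l))
  ¬¬-maximal [] = return (inj₁ λ ())
  ¬¬-maximal (x ∷ l) = do
    yes sx ← ¬¬-excluded-middle {A = S x}
      where no ¬sx → do
              inj₂ (m , sm , max) ← ¬¬-maximal l
                where inj₁ none → return (inj₁ λ { (here refl) → ¬sx ; (there p) → none p })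
              return (inj₂ (m , sm , λ { (here refl) sx _ → ⊥-elim (¬sx sx) ; (there p) → max p }))
    inj₂ (m , sm , max) ← ¬¬-maximal l
      where inj₁ none → return (inj₂ (x , sx , λ { (here refl) _ r → r ; (there p) sy _ → ⊥-elim (none p sy) }))
    yes mx ← ¬¬-excluded-middle {A = R m x}
      where no ¬mx → return (inj₂ (m , sm , λ { (here refl) _ r → ⊥-elim (¬mx r) ; (there p) → max p }))
    return (inj₂ (x , sx , λ { (here refl) _ r → r
                             ; (there p) sy xy → R-trans (max p sy (R-trans mx xy)) mx }))

-- Players and options

data Player : Set where
  Left Right : Player

-- Passed along as a witness so that one proof serves both players; matching on it fixes both
-- indices.
data Opponents : Player → Player → Set where
  LR : Opponents Left Right
  RL : Opponents Right Left

private variable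
  s t : Player
  A B G H K P Q X Z x y z : Game

swap : Opponents s t → Opponents t s
swap LR = RL
swap RL = LR

opponent : ∀ s → ∃ (Opponents s)
opponent Left = Right , LR
opponent Right = Left , RL

#options : Player → Game → ℕ
#options Left (mk n _ _ _) = n
#options Right (mk _ _ n _) = n

optionOf : ∀ s G → Fin (#options s G) → Game
optionOf Left (mk _ L _ _) = L
optionOf Right (mk _ _ _ R) = R

record _⟶[_]_ (G : Game) (s : Player) (x : Game) : Set where
  constructor option
  field
    index : Fin (#options s G)
    at : optionOf s G index ≡ x

infix 4 _⟶[_]_

End : Player → Game → Set
End s G = ¬ ∃ (G ⟶[ s ]_)

end? : ∀ s G → End s G ⊎ ∃ (G ⟶[ s ]_)
end? Left (mk zero _ _ _) = inj₁ λ { (_ , option () _) }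
end? Left (mk (suc _) _ _ _) = inj₂ (_ , option F.zero refl)
end? Right (mk _ _ zero _) = inj₁ λ { (_ , option () _) }
end? Right (mk _ _ (suc _) _) = inj₂ (_ , option F.zero refl)

⊕-option⁻ : A ⊕ B ⟶[ s ] z → (∃[ x ] A ⟶[ s ] x × z ≡ x ⊕ B) ⊎ (∃[ y ] B ⟶[ s ] y × z ≡ A ⊕ y)
⊕-option⁻ {mk nL L _ _} {mk _ _ _ _} {Left} (option i refl) with splitAt nL i
... | inj₁ j = inj₁ (_ , option j refl , refl)
... | inj₂ j = inj₂ (_ , option j refl , refl)
⊕-option⁻ {mk _ _ nR R} {mk _ _ _ _} {Right} (option i refl) with splitAt nR i
... | inj₁ j = inj₁ (_ , option j refl , refl)
... | inj₂ j = inj₂ (_ , option j refl , refl)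

⊕-optionˡ : A ⟶[ s ] x → A ⊕ B ⟶[ s ] x ⊕ B
⊕-optionˡ {mk nL _ _ _} {Left} {B = mk mL _ _ _} (option i refl) =
  option (i ↑ˡ mL) (cong [ _ , _ ] (splitAt-↑ˡ nL i mL))
⊕-optionˡ {mk _ _ nR _} {Right} {B = mk _ _ mR _} (option i refl) =
  option (i ↑ˡ mR) (cong [ _ , _ ] (splitAt-↑ˡ nR i mR))

⊕-optionʳ : B ⟶[ s ] y → A ⊕ B ⟶[ s ] A ⊕ y
⊕-optionʳ {mk mL _ _ _} {Left} {A = mk nL _ _ _} (option i refl) =
  option (nL ↑ʳ i) (cong [ _ , _ ] (splitAt-↑ʳ nL mL i))
⊕-optionʳ {mk _ _ mR _} {Right} {A = mk _ _ nR _} (option i refl) =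
  option (nR ↑ʳ i) (cong [ _ , _ ] (splitAt-↑ʳ nR mR i))

⊕-end : End s A → End s B → End s (A ⊕ B)
⊕-end eA eB (_ , m) with ⊕-option⁻ m
... | inj₁ (_ , n , _) = eA (_ , n)
... | inj₂ (_ , n , _) = eB (_ , n)

0G-end : End s 0G
0G-end {Left} (_ , option () _)
0G-end {Right} (_ , option () _)

conj-option⁻ : Opponents s t → conj G ⟶[ s ] z → ∃[ x ] G ⟶[ t ] x × z ≡ conj x
conj-option⁻ {G = mk _ _ _ _} LR (option i refl) = _ , option i refl , refl
conj-option⁻ {G = mk _ _ _ _} RL (option i refl) = _ , option i refl , refl

conj-option : Opponents s t → G ⟶[ t ] x → conj G ⟶[ s ] conj x
conj-option {G = mk _ _ _ _} LR (option i refl) = option i refl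
conj-option {G = mk _ _ _ _} RL (option i refl) = option i refl

conj-end : Opponents s t → End t G → End s (conj G)
conj-end o e (_ , m) = let _ , n , _ = conj-option⁻ o m in e (_ , n)

-- Followers and well-founded induction

_≺_ : Game → Game → Set
x ≺ G = ∃[ s ] G ⟶[ s ] x

≺-wellFounded : WellFounded _≺_
≺-wellFounded (mk _ L _ R) = acc λ where
  (Left , option i refl) → ≺-wellFounded (L i)
  (Right , option i refl) → ≺-wellFounded (R i)

data _⊑_ : Game → Game → Set where
  ⊑-refl : G ⊑ G
  ⊑-snoc : x ⊑ K → K ≺ G → x ⊑ G

≺-⊑ : x ≺ P → P ⊑ G → x ⊑ G
≺-⊑ m ⊑-refl = ⊑-snoc ⊑-refl m
≺-⊑ m (⊑-snoc p n) = ⊑-snoc (≺-⊑ m p) n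

-- The transitive closure of `_≺_`. Recursions that bypass a reversible option descend two moves at
-- a time.
_⊏_ : Game → Game → Set
x ⊏ G = ∃[ P ] x ≺ P × P ⊑ G

⊏-acc : Acc _≺_ G → x ⊏ G → Acc _⊏_ x
⊏-acc (acc rec) (_ , m , ⊑-refl) = acc (⊏-acc (rec m))
⊏-acc (acc rec) (_ , m , ⊑-snoc p n) = ⊏-acc (rec n) (_ , m , p)

⊏-wellFounded : WellFounded _⊏_
⊏-wellFounded G = acc (⊏-acc (≺-wellFounded G))

≺-⊏ : x ≺ y → y ≺ G → x ⊏ G
≺-⊏ m n = _ , m , ⊑-snoc ⊑-refl n

followers : Game → List Game
followers (mk nL L nR R) =
  mk nL L nR R ∷ (concat (tabulate λ i → followers (L i)) ++ concat (tabulate λ i → followers (R i)))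

∈-followers : x ⊑ G → x ∈ followers G
∈-followers {G = mk _ _ _ _} ⊑-refl = here refl
∈-followers {G = mk _ L _ _} (⊑-snoc p (Left , option i refl)) =
  there (∈-++⁺ˡ (∈-concat⁺′ (∈-followers p) (∈-tabulate⁺ {f = λ j → followers (L j)} i)))
∈-followers {G = mk nL L _ R} (⊑-snoc p (Right , option i refl)) =
  there (∈-++⁺ʳ (concat (tabulate λ j → followers (L j)))
    (∈-concat⁺′ (∈-followers p) (∈-tabulate⁺ {f = λ j → followers (R j)} i)))

-- Winning

wins : Player → Game → Bool
wins Left = leftWinsFirst
wins Right = rightWinsFirst

-- A record rather than the bare equation, so that unification can recover `s` and `G`.
record Wins (s : Player) (G : Game) : Set where
  constructor won
  field
    winsFirst : wins s G ≡ true

wins? : ∀ s G → Dec (Wins s G)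
wins? s G with wins s G in eq
... | true = yes (won eq)
... | false = no λ { (won e) → Bool.not-¬ eq e }

wins-stable : ¬ ¬ Wins s G → Wins s G
wins-stable = decidable-stable (wins? _ _)

anyFin-true⁻ : ∀ n (f : Fin n → Bool) → anyFin n f ≡ true → ∃[ i ] f i ≡ true
anyFin-true⁻ (suc n) f e with f F.zero in eq
... | true = F.zero , eq
... | false = let i , p = anyFin-true⁻ n (λ j → f (F.suc j)) e in F.suc i , p

anyFin-true : ∀ n (f : Fin n → Bool) i → f i ≡ true → anyFin n f ≡ true
anyFin-true (suc n) f F.zero e rewrite e = refl
anyFin-true (suc n) f (F.suc i) e with f F.zero
... | true = refl
... | false = anyFin-true n (λ j → f (F.suc j)) i e

not-true⁻ : ∀ {p} → not p ≡ true → ¬ (p ≡ true)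
not-true⁻ {false} _ ()

not-true : ∀ {p} → ¬ (p ≡ true) → not p ≡ true
not-true {false} _ = refl
not-true {true} n = ⊥-elim (n refl)

wins-move⁻ : Opponents s t → Wins s G → End s G ⊎ (∃[ x ] G ⟶[ s ] x × ¬ Wins t x)
wins-move⁻ {G = mk zero _ _ _} LR _ = inj₁ λ { (_ , option () _) }
wins-move⁻ {G = mk (suc n) L _ _} LR (won e) =
  let i , p = anyFin-true⁻ (suc n) (λ j → not (rightWinsFirst (L j))) e
  in inj₂ (_ , option i refl , λ { (won w) → not-true⁻ p w })
wins-move⁻ {G = mk _ _ zero _} RL _ = inj₁ λ { (_ , option () _) }
wins-move⁻ {G = mk _ _ (suc n) R} RL (won e) =
  let i , p = anyFin-true⁻ (suc n) (λ j → not (leftWinsFirst (R j))) e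
  in inj₂ (_ , option i refl , λ { (won w) → not-true⁻ p w })

wins-end : End s G → Wins s G
wins-end {Left} {mk zero _ _ _} _ = won refl
wins-end {Left} {mk (suc _) _ _ _} e = ⊥-elim (e (_ , option F.zero refl))
wins-end {Right} {mk _ _ zero _} _ = won refl
wins-end {Right} {mk _ _ (suc _) _} e = ⊥-elim (e (_ , option F.zero refl))

wins-move : Opponents s t → G ⟶[ s ] x → ¬ Wins t x → Wins s G
wins-move {G = mk (suc n) L _ _} LR (option i refl) nw =
  won (anyFin-true (suc n) (λ j → not (rightWinsFirst (L j))) i (not-true λ e → nw (won e)))
wins-move {G = mk _ _ (suc n) R} RL (option i refl) nw =
  won (anyFin-true (suc n) (λ j → not (leftWinsFirst (R j))) i (not-true λ e → nw (won e)))

loses-move : Opponents s t → ∃ (G ⟶[ s ]_) → (∀ {x} → G ⟶[ s ] x → Wins t x) → ¬ Wins s G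
loses-move o m f w with wins-move⁻ o w
... | inj₁ e = e m
... | inj₂ (_ , m′ , nw) = nw (f m′)

loses-move⁻ : Opponents s t → ¬ Wins s G → G ⟶[ s ] x → Wins t x
loses-move⁻ o nw m = wins-stable λ nwx → nw (wins-move o m nwx)

loses-nonEnd : ¬ Wins s G → ∃ (G ⟶[ s ]_)
loses-nonEnd {s} {G} nw with end? s G
... | inj₁ e = ⊥-elim (nw (wins-end e))
... | inj₂ m = m

-- Isomorphism of forms

-- These laws fail for _≡_ on forms, but related games have options matched up by
-- _≅_ again, so it is a bisimulation.
infix 4 _≅_
data _≅_ : Game → Game → Set where
  ≅-refl : G ≅ G
  ≅-sym : G ≅ H → H ≅ G
  ≅-trans : G ≅ H → H ≅ K → G ≅ K
  ⊕-congʳ : G ≅ H → G ⊕ K ≅ H ⊕ K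
  ⊕-comm : ∀ A B → A ⊕ B ≅ B ⊕ A
  ⊕-assoc : ∀ A B C → (A ⊕ B) ⊕ C ≅ A ⊕ (B ⊕ C)
  ⊕-identityˡ : ∀ A → 0G ⊕ A ≅ A
  conj-⊕ : ∀ A B → conj (A ⊕ B) ≅ conj A ⊕ conj B
  conj-involutive : ∀ A → conj (conj A) ≅ A
  conj-0G : conj 0G ≅ 0G

≅-option : G ≅ H → G ⟶[ s ] x → ∃[ y ] H ⟶[ s ] y × x ≅ y
≅-option˘ : G ≅ H → H ⟶[ s ] y → ∃[ x ] G ⟶[ s ] x × x ≅ y

≅-option ≅-refl m = _ , m , ≅-refl
≅-option (≅-sym e) m = let _ , n , e′ = ≅-option˘ e m in _ , n , ≅-sym e′
≅-option (≅-trans e f) m =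
  let _ , n , e′ = ≅-option e m
      _ , k , f′ = ≅-option f n
  in _ , k , ≅-trans e′ f′
≅-option (⊕-congʳ e) m with ⊕-option⁻ m
... | inj₁ (_ , n , refl) = let _ , k , e′ = ≅-option e n in _ , ⊕-optionˡ k , ⊕-congʳ e′
... | inj₂ (_ , n , refl) = _ , ⊕-optionʳ n , ⊕-congʳ e
≅-option (⊕-comm A B) m with ⊕-option⁻ m
... | inj₁ (_ , n , refl) = _ , ⊕-optionʳ n , ⊕-comm _ _
... | inj₂ (_ , n , refl) = _ , ⊕-optionˡ n , ⊕-comm _ _
≅-option (⊕-assoc A B C) m with ⊕-option⁻ m
... | inj₂ (_ , n , refl) = _ , ⊕-optionʳ (⊕-optionʳ n) , ⊕-assoc _ _ _
... | inj₁ (_ , n , refl) with ⊕-option⁻ n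
... | inj₁ (_ , k , refl) = _ , ⊕-optionˡ k , ⊕-assoc _ _ _
... | inj₂ (_ , k , refl) = _ , ⊕-optionʳ (⊕-optionˡ k) , ⊕-assoc _ _ _
≅-option (⊕-identityˡ A) m with ⊕-option⁻ m
... | inj₁ (_ , n , refl) = ⊥-elim (0G-end (_ , n))
... | inj₂ (_ , n , refl) = _ , n , ⊕-identityˡ _
≅-option {s = s} (conj-⊕ A B) m with opponent s
... | t , o with conj-option⁻ o m
... | _ , n , refl with ⊕-option⁻ n
... | inj₁ (_ , k , refl) = _ , ⊕-optionˡ (conj-option o k) , conj-⊕ _ _
... | inj₂ (_ , k , refl) = _ , ⊕-optionʳ (conj-option o k) , conj-⊕ _ _
≅-option {s = s} (conj-involutive A) m with opponent s
... | t , o with conj-option⁻ o m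
... | _ , n , refl with conj-option⁻ (swap o) n
... | _ , k , refl = _ , k , conj-involutive _
≅-option {s = s} conj-0G m = ⊥-elim (conj-end (proj₂ (opponent s)) 0G-end (_ , m))

≅-option˘ ≅-refl m = _ , m , ≅-refl
≅-option˘ (≅-sym e) m = let _ , n , e′ = ≅-option e m in _ , n , ≅-sym e′
≅-option˘ (≅-trans e f) m =
  let _ , n , f′ = ≅-option˘ f m
      _ , k , e′ = ≅-option˘ e n
  in _ , k , ≅-trans e′ f′
≅-option˘ (⊕-congʳ e) m with ⊕-option⁻ m
... | inj₁ (_ , n , refl) = let _ , k , e′ = ≅-option˘ e n in _ , ⊕-optionˡ k , ⊕-congʳ e′
... | inj₂ (_ , n , refl) = _ , ⊕-optionʳ n , ⊕-congʳ e
≅-option˘ (⊕-comm A B) m with ⊕-option⁻ m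
... | inj₁ (_ , n , refl) = _ , ⊕-optionʳ n , ⊕-comm _ _
... | inj₂ (_ , n , refl) = _ , ⊕-optionˡ n , ⊕-comm _ _
≅-option˘ (⊕-assoc A B C) m with ⊕-option⁻ m
... | inj₁ (_ , n , refl) = _ , ⊕-optionˡ (⊕-optionˡ n) , ⊕-assoc _ _ _
... | inj₂ (_ , n , refl) with ⊕-option⁻ n
... | inj₁ (_ , k , refl) = _ , ⊕-optionˡ (⊕-optionʳ k) , ⊕-assoc _ _ _
... | inj₂ (_ , k , refl) = _ , ⊕-optionʳ k , ⊕-assoc _ _ _
≅-option˘ (⊕-identityˡ A) m = _ , ⊕-optionʳ m , ⊕-identityˡ _
≅-option˘ {s = s} (conj-⊕ A B) m with opponent s
... | t , o with ⊕-option⁻ m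
... | inj₁ (_ , n , refl) with conj-option⁻ o n
...   | _ , k , refl = _ , conj-option o (⊕-optionˡ k) , conj-⊕ _ _
≅-option˘ {s = s} (conj-⊕ A B) m | t , o | inj₂ (_ , n , refl) with conj-option⁻ o n
...   | _ , k , refl = _ , conj-option o (⊕-optionʳ k) , conj-⊕ _ _
≅-option˘ {s = s} (conj-involutive A) m =
  let _ , o = opponent s
  in _ , conj-option o (conj-option (swap o) m) , conj-involutive _
≅-option˘ conj-0G m = ⊥-elim (0G-end (_ , m))

-- After a move, a win turns into a loss of the other player, so each direction calls the other one
-- on options.
wins-≅-acc : Acc _≺_ G → G ≅ H → Opponents s t → (Wins s G → Wins s H) × (Wins s H → Wins s G)
wins-≅-acc {s = s} (acc rec) e o = to , from
  where
  to : Wins s _ → Wins s _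
  to w with wins-move⁻ o w
  ... | inj₁ end = wins-end λ (_ , m) → let _ , n , _ = ≅-option˘ e m in end (_ , n)
  ... | inj₂ (_ , m , nw) =
    let _ , n , e′ = ≅-option e m
    in wins-move o n (nw ∘ proj₂ (wins-≅-acc (rec (_ , m)) e′ (swap o)))
  from : Wins s _ → Wins s _
  from w with wins-move⁻ o w
  ... | inj₁ end = wins-end λ (_ , m) → let _ , n , _ = ≅-option e m in end (_ , n)
  ... | inj₂ (_ , m , nw) =
    let _ , n , e′ = ≅-option˘ e m
    in wins-move o n (nw ∘ proj₁ (wins-≅-acc (rec (_ , n)) e′ (swap o)))

wins-≅ : G ≅ H → Wins s G → Wins s H
wins-≅ e = proj₁ (wins-≅-acc (≺-wellFounded _) e (proj₂ (opponent _)))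

wins-conj-acc : Acc _≺_ G → Opponents s t → (Wins s (conj G) → Wins t G) × (Wins t G → Wins s (conj G))
wins-conj-acc {G} {s} {t} (acc rec) o = to , from
  where
  to : Wins s (conj G) → Wins t G
  to w with wins-move⁻ o w
  ... | inj₁ end = wins-end λ (_ , m) → end (_ , conj-option o m)
  ... | inj₂ (_ , m , nw) with conj-option⁻ o m
  ... | _ , n , refl = wins-move (swap o) n (nw ∘ proj₂ (wins-conj-acc (rec (_ , n)) (swap o)))
  from : Wins t G → Wins s (conj G)
  from w with wins-move⁻ (swap o) w
  ... | inj₁ end = wins-end (conj-end o end)
  ... | inj₂ (_ , m , nw) =
    wins-move o (conj-option o m) (nw ∘ proj₁ (wins-conj-acc (rec (_ , m)) (swap o)))

wins-conj⁻ : Opponents s t → Wins s (conj G) → Wins t G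
wins-conj⁻ = proj₁ ∘ wins-conj-acc (≺-wellFounded _)

wins-conj : Opponents s t → Wins t G → Wins s (conj G)
wins-conj = proj₂ ∘ wins-conj-acc (≺-wellFounded _)

⊕-congˡ : G ≅ H → K ⊕ G ≅ K ⊕ H
⊕-congˡ e = ≅-trans (⊕-comm _ _) (≅-trans (⊕-congʳ e) (⊕-comm _ _))

⊕-commutativeMonoid : CommutativeMonoid _ _
⊕-commutativeMonoid = record
  { Carrier = Game
  ; _≈_ = _≅_
  ; _∙_ = _⊕_
  ; ε = 0G
  ; isCommutativeMonoid = record
    { isMonoid = record
      { isSemigroup = record
        { isMagma = record
          { isEquivalence = record { refl = ≅-refl ; sym = ≅-sym ; trans = ≅-trans }
          ; ∙-cong = λ e f → ≅-trans (⊕-congʳ e) (⊕-congˡ f) }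
        ; assoc = ⊕-assoc }
      ; identity = ⊕-identityˡ , λ A → ≅-trans (⊕-comm A 0G) (⊕-identityˡ A) }
    ; comm = ⊕-comm } }

private module Sum = MonoidSolver ⊕-commutativeMonoid

-- The outcome order in terms of wins

outcome-≥⁻ : ∀ p q p′ q′ → outcomeOf p q ≥o outcomeOf p′ q′ → (p′ ≡ true → p ≡ true) × (q ≡ true → q′ ≡ true)
outcome-≥⁻ true  false _     _     _ = (λ _ → refl) , λ ()
outcome-≥⁻ true  true  _     true  _ = (λ _ → refl) , λ _ → refl
outcome-≥⁻ false false false _     _ = (λ ()) , λ ()
outcome-≥⁻ false true  false true  _ = (λ ()) , λ _ → refl
outcome-≥⁻ true  true  true  false ()
outcome-≥⁻ true  true  false false ()
outcome-≥⁻ false false true  true  ()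
outcome-≥⁻ false false true  false ()
outcome-≥⁻ false true  true  true  ()
outcome-≥⁻ false true  true  false ()
outcome-≥⁻ false true  false false ()

outcome-≥ : ∀ p q p′ q′ → (p′ ≡ true → p ≡ true) → (q ≡ true → q′ ≡ true) → outcomeOf p q ≥o outcomeOf p′ q′
outcome-≥ false _     true  _     f _ with () ← f refl
outcome-≥ _     true  _     false _ g with () ← g refl
outcome-≥ true  true  true  true  _ _ = refl≥
outcome-≥ true  true  false true  _ _ = N≥R
outcome-≥ true  false true  true  _ _ = L≥N
outcome-≥ true  false true  false _ _ = refl≥
outcome-≥ true  false false true  _ _ = L≥R
outcome-≥ true  false false false _ _ = L≥P
outcome-≥ false true  false true  _ _ = refl≥
outcome-≥ false false false true  _ _ = P≥R
outcome-≥ false false false false _ _ = refl≥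

-- Comparison modulo a universe

-- x ≼[ s , t ] y: the player s, with opponent t, likes y at least as much as x.
module Ordering {ℓ : Level} (𝒰 : GameSet ℓ) (universe : IsUniverse 𝒰) where
  open IsUniverse universe

  option-closed : 𝒰 G → G ⟶[ s ] x → 𝒰 x
  option-closed {G = mk _ _ _ _} {Left} u (option i refl) = leftOpt-closed _ _ _ _ u i
  option-closed {G = mk _ _ _ _} {Right} u (option i refl) = rightOpt-closed _ _ _ _ u i

  ⊑-closed : 𝒰 G → P ⊑ G → 𝒰 P
  ⊑-closed u ⊑-refl = u
  ⊑-closed u (⊑-snoc p (_ , m)) = ⊑-closed (option-closed u m) p

  infix 4 _≼[_,_]_
  record _≼[_,_]_ (G : Game) (s t : Player) (H : Game) : Set ℓ where
    constructor le
    field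
      keeps : 𝒰 X → Wins s (G ⊕ X) → Wins s (H ⊕ X)
      blocks : 𝒰 X → Wins t (H ⊕ X) → Wins t (G ⊕ X)

  open _≼[_,_]_

  flip : G ≼[ s , t ] H → H ≼[ t , s ] G
  flip (le f g) = le g f

  ≼-stable : ¬ ¬ (G ≼[ s , t ] H) → G ≼[ s , t ] H
  ≼-stable m = le (λ u w → wins-stable λ n → m λ p → n (keeps p u w))
                  (λ u w → wins-stable λ n → m λ p → n (blocks p u w))

  ≼-trans : G ≼[ s , t ] H → H ≼[ s , t ] K → G ≼[ s , t ] K
  ≼-trans p q = le (λ u → keeps q u ∘ keeps p u) (λ u → blocks p u ∘ blocks q u)

  ≅⇒≼ : G ≅ H → G ≼[ s , t ] H
  ≅⇒≼ e = le (λ _ → wins-≅ (⊕-congʳ e)) (λ _ → wins-≅ (⊕-congʳ (≅-sym e)))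

  ≼-refl : G ≼[ s , t ] G
  ≼-refl = ≅⇒≼ ≅-refl

  ⊕-monoˡ : 𝒰 K → G ≼[ s , t ] H → G ⊕ K ≼[ s , t ] H ⊕ K
  ⊕-monoˡ uK p = le
    (λ u → wins-≅ (≅-sym (⊕-assoc _ _ _)) ∘ keeps p (sum-closed _ _ uK u) ∘ wins-≅ (⊕-assoc _ _ _))
    (λ u → wins-≅ (≅-sym (⊕-assoc _ _ _)) ∘ blocks p (sum-closed _ _ uK u) ∘ wins-≅ (⊕-assoc _ _ _))

  ⊕-mono : 𝒰 A → 𝒰 K → G ≼[ s , t ] A → H ≼[ s , t ] K → 𝒰 H → G ⊕ H ≼[ s , t ] A ⊕ K
  ⊕-mono uA uK p q uH =
    ≼-trans (⊕-monoˡ uH p)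
      (≼-trans (≅⇒≼ (⊕-comm _ _)) (≼-trans (⊕-monoˡ uA q) (≅⇒≼ (⊕-comm _ _))))

  -- y need not be invertible.
  pocancellation : 𝒰 x → 𝒰 z → x ⊕ y ≼[ s , t ] 0G → z ⊕ y ≼[ t , s ] 0G → x ≼[ s , t ] z
  pocancellation {x} {z} {y} ux uz p q =
    ≼-trans (≅⇒≼ (≅-sym (⊕-identityˡ x)))
    (≼-trans (⊕-monoˡ ux (flip q))
    (≼-trans (≅⇒≼ (Sum.solve 3 (λ a b c → (c Sum.⊕ b) Sum.⊕ a Sum.⊜ (a Sum.⊕ b) Sum.⊕ c) ≅-refl x y z))
    (≼-trans (⊕-monoˡ uz p) (≅⇒≼ (⊕-identityˡ z)))))

  wins-reflect : Opponents s t → Wins t (conj G ⊕ X) → Wins s (G ⊕ conj X)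
  wins-reflect o w =
    wins-≅ (≅-trans (conj-⊕ _ _) (⊕-congʳ (conj-involutive _))) (wins-conj o w)

  wins-reflect⁻ : Opponents s t → Wins s (G ⊕ conj X) → Wins t (conj G ⊕ X)
  wins-reflect⁻ o w =
    wins-≅ (≅-trans (conj-⊕ _ _) (⊕-congˡ (conj-involutive _))) (wins-conj (swap o) w)

  conj-antitone : Opponents s t → G ≼[ s , t ] H → conj G ≼[ t , s ] conj H
  conj-antitone o p = le
    (λ u → wins-reflect⁻ o ∘ keeps p (conj-closed _ u) ∘ wins-reflect o)
    (λ u → wins-reflect⁻ (swap o) ∘ blocks p (conj-closed _ u) ∘ wins-reflect (swap o))

  -- Adjoints, distinguishing games and maintenance

  zeroForm : Acc _≺_ G → 𝒰 G → ∃[ z ] 𝒰 z × (∀ s → End s z)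
  zeroForm {G} (acc rec) u with end? Left G | end? Right G
  ... | inj₂ (_ , m) | _ = zeroForm (rec (_ , m)) (option-closed u m)
  ... | inj₁ _ | inj₂ (_ , m) = zeroForm (rec (_ , m)) (option-closed u m)
  -- `0G` itself is not known to lie in `𝒰`, as its empty families need not be definitionally those
  -- of `G`.
  ... | inj₁ eL | inj₁ eR = G , u , λ { Left → eL ; Right → eR }

  -- The only s-option is x; z keeps the set of t-options non-empty.
  form : Opponents s t → Game → Game → ∀ {n} → (Fin n → Game) → Game
  form LR x z {n} f = mk 1 (λ _ → x) (suc n) (z Vector.∷ f)
  form RL x z {n} f = mk (suc n) (z Vector.∷ f) 1 (λ _ → x)

  module _ {n} {f : Fin n → Game} where

    form-sole : (o : Opponents s t) → form o x z f ⟶[ s ] x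
    form-sole LR = option F.zero refl
    form-sole RL = option F.zero refl

    form-sole⁻ : (o : Opponents s t) → form o x z f ⟶[ s ] y → y ≡ x
    form-sole⁻ LR (option F.zero refl) = refl
    form-sole⁻ RL (option F.zero refl) = refl

    form-family : (o : Opponents s t) → ∀ i → form o x z f ⟶[ t ] f i
    form-family LR i = option (F.suc i) refl
    form-family RL i = option (F.suc i) refl

    form-options⁻ : (o : Opponents s t) → form o x z f ⟶[ t ] y → y ≡ z ⊎ (∃[ i ] y ≡ f i)
    form-options⁻ LR (option F.zero refl) = inj₁ refl
    form-options⁻ LR (option (F.suc i) refl) = inj₂ (i , refl)
    form-options⁻ RL (option F.zero refl) = inj₁ refl
    form-options⁻ RL (option (F.suc i) refl) = inj₂ (i , refl)

    form-default : (o : Opponents s t) → form o x z f ⟶[ t ] z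
    form-default LR = option F.zero refl
    form-default RL = option F.zero refl

    form-closed : (o : Opponents s t) → 𝒰 x → 𝒰 z → (∀ i → 𝒰 (f i)) → 𝒰 (form o x z f)
    form-closed LR ux uz uf = build-closed 0 _ n _ (λ _ → ux) λ { F.zero → uz ; (F.suc i) → uf i }
    form-closed RL ux uz uf = build-closed n _ 0 _ (λ { F.zero → uz ; (F.suc i) → uf i }) (λ _ → ux)

  module Distinguishing {z : Game} (uz : 𝒰 z) (z-end : ∀ s → End s z) where

    -- Each first move of `s` has a reply: after a move in `G`, `t` moves in `A` to the adjoint of
    -- that option; after the sole move in `A`, `t` faces `threatened`, chosen so that `t` wins
    -- moving first.
    adjoint : Acc _≺_ G → Opponents s t → 𝒰 G → ∃[ A ] 𝒰 A × ¬ Wins s (G ⊕ A)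
    adjoint {G} {s} {t} (acc rec) o u =
      form o threatened z (proj₁ ∘ replies) ,
      form-closed o threatened-closed uz (proj₁ ∘ proj₂ ∘ replies) ,
      loses-move o (_ , ⊕-optionʳ (form-sole o)) answered
      where
      replies : ∀ i → ∃[ A ] 𝒰 A × ¬ Wins s (optionOf s G i ⊕ A)
      replies i = adjoint (rec (s , option i refl)) o (option-closed u (option {s = s} i refl))

      threat : ∃[ x ] 𝒰 x × Wins t (G ⊕ x)
      threat with end? t G
      -- Either `t` cannot move in `G ⊕ z` and wins by the misère rule, or `t` moves in `G` to an
      -- option whose adjoint is the threat.
      ... | inj₁ e = z , uz , wins-end (⊕-end e (z-end t))
      ... | inj₂ (_ , m) =
        let A , uA , nw = adjoint (rec (t , m)) o (option-closed u m)
        in A , uA , wins-move (swap o) (⊕-optionˡ m) nw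

      threatened : Game
      threatened = proj₁ threat

      threatened-closed : 𝒰 threatened
      threatened-closed = proj₁ (proj₂ threat)

      answered : ∀ {y} → G ⊕ form o threatened z (proj₁ ∘ replies) ⟶[ s ] y → Wins t y
      answered m with ⊕-option⁻ m
      ... | inj₁ (_ , option i refl , refl) =
        wins-move (swap o) (⊕-optionʳ (form-family o i)) (proj₂ (proj₂ (replies i)))
      ... | inj₂ (_ , n , refl) with form-sole⁻ o n
      ... | refl = proj₂ (proj₂ threat)

    -- The comparison may fail with either player moving first. A failure with `t` first has the
    -- required shape. One with `s` first is delayed by a move: `X` becomes the sole option of `t`
    -- in a game where `s` can punish each move of `t` in `G` by an adjoint.
    distinguish : Opponents s t → 𝒰 G → ¬ (G ≼[ s , t ] 0G) →
                  ¬ ¬ (∃[ X ] 𝒰 X × Wins t X × ¬ Wins t (G ⊕ X))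
    distinguish {s} {t} {G} o u n k = n (le slow fast)
      where
      fast : 𝒰 X → Wins t (0G ⊕ X) → Wins t (G ⊕ X)
      fast uX w = wins-stable λ nw → k (_ , uX , wins-≅ (⊕-identityˡ _) w , nw)

      replies : ∀ i → ∃[ A ] 𝒰 A × ¬ Wins t (optionOf t G i ⊕ A)
      replies i = adjoint (≺-wellFounded _) (swap o) (option-closed u (option {s = t} i refl))

      answered : Wins s (G ⊕ X) → G ⊕ form (swap o) X z (proj₁ ∘ replies) ⟶[ t ] y → Wins s y
      answered w m with ⊕-option⁻ m
      ... | inj₁ (_ , option i refl , refl) =
        wins-move o (⊕-optionʳ (form-family (swap o) i)) (proj₂ (proj₂ (replies i)))
      ... | inj₂ (_ , m′ , refl) with form-sole⁻ (swap o) m′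
      ... | refl = w

      slow : 𝒰 X → Wins s (G ⊕ X) → Wins s (0G ⊕ X)
      slow {X} uX w = wins-stable λ nw → k
        ( form (swap o) X z (proj₁ ∘ replies)
        , form-closed (swap o) uX uz (proj₁ ∘ proj₂ ∘ replies)
        , wins-move (swap o) (form-sole (swap o)) (nw ∘ wins-≅ (≅-sym (⊕-identityˡ X)))
        , loses-move (swap o) (_ , ⊕-optionʳ (form-sole (swap o))) (answered w) )

    -- Otherwise every option of `t` in `x` has a distinguishing game. Assembled into `test`, these
    -- let `s` win `G ⊕ test` by moving to `x`, while `s` moving first loses `test` alone, against
    -- the hypothesis on `G`.
    maintenance : Opponents s t → 𝒰 G → G ≼[ s , t ] 0G → G ⟶[ s ] x →
                  ¬ ¬ (∃[ y ] x ⟶[ t ] y × y ≼[ s , t ] 0G)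
    maintenance {s} {t} {G} {x} o u p m none =
      ¬¬-choice (λ i → distinguish o (option-closed ux (option {s = t} i refl))
                         λ q → none (_ , option i refl , q)) refute
      where
      ux : 𝒰 x
      ux = option-closed u m

      refute : ¬ (∀ i → ∃[ X ] 𝒰 X × Wins t X × ¬ Wins t (optionOf t x i ⊕ X))
      refute X = loses-move o (_ , form-default (swap o)) allWin
                   (wins-≅ (⊕-identityˡ test) (keeps p test-closed (wins-move o (⊕-optionˡ m) x-loses)))
        where
        adj = adjoint (≺-wellFounded x) (swap o) ux

        parry test : Game
        -- If `t` escapes to `parry`, the only option of `s` there is the adjoint of `x`, and `t`
        -- loses.
        parry = form o (proj₁ adj) z {0} λ ()
        test = form (swap o) parry z (proj₁ ∘ X)

        test-closed : 𝒰 test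
        test-closed = form-closed (swap o) (form-closed o (proj₁ (proj₂ adj)) uz λ ()) uz (proj₁ ∘ proj₂ ∘ X)

        allWin : ∀ {y} → test ⟶[ s ] y → Wins t y
        allWin n with form-options⁻ (swap o) n
        ... | inj₁ refl = wins-end (z-end t)
        ... | inj₂ (i , refl) = proj₁ (proj₂ (proj₂ (X i)))

        answered : ∀ {y} → x ⊕ test ⟶[ t ] y → Wins s y
        answered n with ⊕-option⁻ n
        ... | inj₁ (_ , option i refl , refl) =
          wins-move o (⊕-optionʳ (form-family (swap o) i)) (proj₂ (proj₂ (proj₂ (X i))))
        ... | inj₂ (_ , k , refl) with form-sole⁻ (swap o) k
        ... | refl = wins-move o (⊕-optionʳ (form-sole o)) (proj₂ (proj₂ adj))

        x-loses : ¬ Wins t (x ⊕ test)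
        x-loses = loses-move (swap o) (_ , ⊕-optionʳ (form-sole (swap o))) answered

  -- Maintenance for a sum, split by the summand in which `t` answers; chains of replies are built
  -- from it.
  reply : Opponents s t → 𝒰 A → 𝒰 B → A ⊕ B ≼[ s , t ] 0G → A ⟶[ s ] x →
          ¬ ¬ ((∃[ y ] x ⟶[ t ] y × y ⊕ B ≼[ s , t ] 0G) ⊎ (∃[ y ] B ⟶[ t ] y × x ⊕ y ≼[ s , t ] 0G))
  reply o uA uB p m = do
    _ , n , q ← maintenance o (sum-closed _ _ uA uB) p (⊕-optionˡ m)
    return (split n q)
    where
    zf = zeroForm (≺-wellFounded _) uA
    open Distinguishing (proj₁ (proj₂ zf)) (proj₂ (proj₂ zf))
    split : x ⊕ B ⟶[ t ] z → z ≼[ s , t ] 0G →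
            (∃[ y ] x ⟶[ t ] y × y ⊕ B ≼[ s , t ] 0G) ⊎ (∃[ y ] B ⟶[ t ] y × x ⊕ y ≼[ s , t ] 0G)
    split n q with ⊕-option⁻ n
    ... | inj₁ (_ , k , refl) = inj₁ (_ , k , q)
    ... | inj₂ (_ , k , refl) = inj₂ (_ , k , q)

  -- Inverse pairs

  record Inverses (G H : Game) : Set ℓ where
    field
      closedˡ : 𝒰 G
      closedʳ : 𝒰 H
      null : Opponents s t → G ⊕ H ≼[ s , t ] 0G

  open Inverses

  inverses : Opponents s t → 𝒰 G → 𝒰 H → G ⊕ H ≼[ s , t ] 0G → G ⊕ H ≼[ t , s ] 0G → Inverses G H
  inverses o uG uH p q = record { closedˡ = uG ; closedʳ = uH ; null = pick o p q }
    where
    pick : ∀ {s t s′ t′ A} → Opponents s t → A ≼[ s , t ] 0G → A ≼[ t , s ] 0G →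
           Opponents s′ t′ → A ≼[ s′ , t′ ] 0G
    pick LR p q LR = p
    pick LR p q RL = q
    pick RL p q LR = q
    pick RL p q RL = p

  ⊕-comm-≼0 : A ⊕ B ≼[ s , t ] 0G → B ⊕ A ≼[ s , t ] 0G
  ⊕-comm-≼0 p = ≼-trans (≅⇒≼ (⊕-comm _ _)) p

  Inverses-sym : Inverses G H → Inverses H G
  Inverses-sym inv = record
    { closedˡ = closedʳ inv ; closedʳ = closedˡ inv ; null = ⊕-comm-≼0 ∘ null inv }

  inverse-unique : Inverses x y → Inverses z y → Opponents s t → x ≼[ s , t ] z
  inverse-unique i j o = pocancellation (closedˡ i) (closedˡ j) (null i o) (null j (swap o))

  ≼-inverse : Inverses G H → Opponents s t → P ≼[ s , t ] H → P ⊕ G ≼[ s , t ] 0G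
  ≼-inverse inv o p = ≼-trans (⊕-monoˡ (closedˡ inv) p) (⊕-comm-≼0 (null inv o))

  -- By the bound on `y`, `H ⊕ y` is at least `0G` for `s`, and `y` cancels. This excludes replies:
  -- an answer inside an option would make that option reversible.
  inverse-≼ : Inverses G H → Opponents s t → 𝒰 x → y ≼[ t , s ] G → x ⊕ y ≼[ s , t ] 0G → x ≼[ s , t ] H
  inverse-≼ inv o ux q p =
    pocancellation ux (closedʳ inv) p (⊕-comm-≼0 (≼-inverse (Inverses-sym inv) (swap o) q))

  -- Both `y` and `conj x` are inverse to `x`, hence equivalent, so `y ⊕ conj y` is equivalent to
  -- `conj x ⊕ x`.
  conj-inverse : Inverses x y → Inverses x (conj x) → Inverses y (conj y)
  conj-inverse {x} {y} i j = record
    { closedˡ = closedʳ i ; closedʳ = conj-closed _ (closedʳ i) ; null = λ o →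
      ≼-trans (⊕-mono (closedʳ j) (closedˡ i) (y≼x̄ o)
                (≼-trans (conj-antitone (swap o) (y≼x̄ (swap o))) (≅⇒≼ (conj-involutive x)))
                (conj-closed _ (closedʳ i)))
              (⊕-comm-≼0 (null j o)) }
    where
    y≼x̄ : Opponents s t → y ≼[ s , t ] conj x
    y≼x̄ = inverse-unique (Inverses-sym i) (Inverses-sym j)

  -- `G ⊕ conj G` and `0G` are their own conjugates up to `_≅_`, and conjugation reverses the order.
  conj-null : Opponents s t → G ⊕ conj G ≼[ s , t ] 0G → G ⊕ conj G ≼[ t , s ] 0G
  conj-null {G = G} o p =
    ≼-trans (≅⇒≼ (≅-trans (⊕-comm _ _) (≅-trans (⊕-congˡ (≅-sym (conj-involutive G))) (≅-sym (conj-⊕ _ _)))))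
      (≼-trans (conj-antitone o p) (≅⇒≼ conj-0G))

  -- Reversibility and matching of options

  -- The source will be H or a position through which some option of H reverses.
  record Effective (s t : Player) (H x : Game) : Set ℓ where
    constructor effective
    field
      {source} : Game
      follower : source ⊑ H
      below : source ≼[ s , t ] H
      move : source ⟶[ s ] x

  open Effective

  Effective-⊏ : Effective s t H x → x ⊏ H
  Effective-⊏ e = _ , (_ , move e) , follower e

  Effective-⊑ : Effective s t H x → x ⊑ H
  Effective-⊑ e = ≺-⊑ (_ , move e) (follower e)

  Reversible : Player → Player → Game → Game → Set ℓ
  Reversible s t H x = ∃[ y ] x ⟶[ t ] y × y ≼[ s , t ] H

  -- If `y` reverses through `y′`, the answer to the move `y′` cannot lie in `x`, which would then
  -- be reversible. So it is an option `y″` of `y′`, again effective and a proper follower of `y`.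
  nonReversible-reply : Inverses G H → Opponents s t → 𝒰 x → ¬ Reversible s t H x →
    Acc _⊏_ y → Effective t s G y → x ⊕ y ≼[ s , t ] 0G →
    ¬ ¬ (∃[ z ] Effective t s G z × ¬ Reversible t s G z × x ⊕ z ≼[ s , t ] 0G)
  nonReversible-reply {G} {s = s} {t} {x} {y} inv o ux nx (acc rec) ey p = do
    yes (y′ , m , q) ← ¬¬-excluded-middle {A = Reversible t s G y}
      where no ny → return (_ , ey , ny , p)
    let uy = ⊑-closed (closedˡ inv) (Effective-⊑ ey)
        uy′ = option-closed uy m
    inj₁ (y″ , n , p′) ← reply o uy ux (⊕-comm-≼0 p) m
      where inj₂ (x′ , n , p′) → ⊥-elim (nx (_ , n , inverse-≼ inv o (option-closed ux n) q (⊕-comm-≼0 p′)))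
    nonReversible-reply inv o ux nx (rec (≺-⊏ (_ , n) (_ , m)))
      (effective (≺-⊑ (_ , m) (Effective-⊑ ey)) q n) (⊕-comm-≼0 p′)

  record Matched (s t : Player) (G H x : Game) : Set ℓ where
    field
      {partner} {dual} : Game
      partner-effective : Effective s t H partner
      dual-effective : Effective t s G dual
      dominates : x ≼[ s , t ] partner
      partner-dual : Inverses partner dual

  open Matched

  -- A maximal non-reversible option lies in a cycle of replies, hence is invertible.
  match : Inverses G H → Opponents s t → Effective s t H x → ¬ Reversible s t H x → ¬ ¬ Matched s t G H x
  match {G} {H} {s} {t} {x} inv o ex nx = do
    -- Effective moves are followers of `H`, which form a finite list, so a maximal candidate above
    -- `x` can be picked.
    inj₂ (x* , (e* , n* , x≼x*) , maximal) ← ¬¬-maximal {R = _≼[ s , t ]_} {S = Candidate} ≼-trans (followers H)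
      where inj₁ none → ⊥-elim (none (∈-followers (Effective-⊑ ex)) (ex , nx , ≼-refl))
    let u* = ⊑-closed (closedʳ inv) (Effective-⊑ e*)
    inj₂ (y₀ , m₀ , p₀) ← reply o (⊑-closed (closedʳ inv) (follower e*)) (closedˡ inv) (≼-inverse inv o (below e*)) (move e*)
      where inj₁ (x′ , m , p) → ⊥-elim (n* (_ , m , inverse-≼ inv o (option-closed u* m) ≼-refl p))
    y , ey , ny , p ← nonReversible-reply inv o u* n* (⊏-wellFounded y₀) (effective ⊑-refl ≼-refl m₀) p₀
    let uy = ⊑-closed (closedˡ inv) (Effective-⊑ ey)
    inj₂ (x₁ , m₁ , p₁) ← reply (swap o) (⊑-closed (closedˡ inv) (follower ey)) (closedʳ inv)
                            (≼-inverse (Inverses-sym inv) (swap o) (below ey)) (move ey)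
      where inj₁ (y′ , m , q) → ⊥-elim (ny (_ , m , inverse-≼ (Inverses-sym inv) (swap o) (option-closed uy m) ≼-refl q))
    x₂ , e₂ , n₂ , p₂ ← nonReversible-reply (Inverses-sym inv) (swap o) uy ny (⊏-wellFounded x₁)
                          (effective ⊑-refl ≼-refl m₁) p₁
    let u₂ = ⊑-closed (closedʳ inv) (Effective-⊑ e₂)
        -- Cancelling `y` puts `x₂` above `x*`; maximality reverses this, which supplies the missing
        -- half of `x* ⊕ y` being null.
        x*≼x₂ = pocancellation u* u₂ p (⊕-comm-≼0 p₂)
        x₂≼x* = maximal (∈-followers (Effective-⊑ e₂)) (e₂ , n₂ , ≼-trans x≼x* x*≼x₂) x*≼x₂
    return (record
      { partner-effective = e* ; dual-effective = ey ; dominates = x≼x*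
      ; partner-dual = inverses o u* uy p
          (≼-trans (⊕-monoˡ uy (flip x₂≼x*)) (⊕-comm-≼0 p₂)) })
    where
    Candidate : Game → Set ℓ
    Candidate z = Effective s t H z × ¬ Reversible s t H z × x ≼[ s , t ] z

  -- Strong games and comparison with the conjugate

  ConjInverses : Game → Game → Set ℓ
  ConjInverses G H = ∀ {x y} → x ⊏ G → y ⊏ H → Inverses x y → Inverses x (conj x) × Inverses y (conj y)

  ConjInverses-sym : ConjInverses G H → ConjInverses H G
  ConjInverses-sym f p q i = let j , k = f q p (Inverses-sym i) in k , j

  Strong : Player → Player → Game → Set ℓ
  Strong s t G = ∃[ E ] 𝒰 E × End s E × E ≼[ s , t ] G

  -- The conjugate of the given end is an end for `s`; in its sum with `Z`, player `s` has no move
  -- and so wins.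
  strong-conj-wins : Opponents s t → Strong t s G → 𝒰 Z → End s Z → Wins s (conj G ⊕ Z)
  strong-conj-wins o (_ , _ , eE , p) uZ eZ =
    keeps (conj-antitone (swap o) p) uZ (wins-end (⊕-end (conj-end o eE) eZ))

  -- The possible sources of a win of `s` moving first in `H ⊕ Z`: a move in `Z`, a move in `H` that
  -- can be copied in `conj G`, or having no move.
  Transfer : Player → Player → Game → Game → Game → Set ℓ
  Transfer s t G H Z =
    (∃[ Z′ ] Z ⟶[ s ] Z′ × ¬ Wins t (H ⊕ Z′)) ⊎ (Wins s (conj G ⊕ Z) ⊎ (End s Z × Strong s t H))

  -- The winning move is traced from a position `P` that starts as `H` and descends through
  -- reversals. A non-reversible option is dominated by an invertible `partner`. By `ih` its inverse
  -- `dual` is also inverse to `conj dual`, so `partner` is equivalent to `conj dual`, a move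
  -- available in `conj G` up to comparison.
  transfer : Inverses G H → ConjInverses G H → Opponents s t → 𝒰 Z →
             Acc _⊏_ P → P ⊑ H → P ≼[ s , t ] H → Wins s (P ⊕ Z) → ¬ ¬ Transfer s t G H Z
  transfer {G} {H} {s} {t} {Z} {P} inv ih o uZ (acc rec) P⊑H P≼H w with wins-move⁻ o w
  ... | inj₁ end = return (inj₂ (inj₂ ((λ (_ , m) → end (_ , ⊕-optionʳ m)) ,
                     _ , ⊑-closed (closedʳ inv) P⊑H , (λ (_ , m) → end (_ , ⊕-optionˡ m)) , P≼H)))
  ... | inj₂ (_ , m , nw) with ⊕-option⁻ m
  ... | inj₂ (_ , n , refl) = return (inj₁ (_ , n , nw ∘ blocks P≼H (option-closed uZ n)))
  ... | inj₁ (x , n , refl) = do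
    no nx ← ¬¬-excluded-middle {A = Reversible s t H x}
      where yes (x′ , k , q) →
              transfer inv ih o uZ (rec (≺-⊏ (_ , k) (_ , n))) (≺-⊑ (_ , k) (≺-⊑ (_ , n) P⊑H)) q
                (loses-move⁻ (swap o) nw (⊕-optionˡ k))
    mt ← match inv o (effective P⊑H P≼H n) nx
    let y≡ȳ = proj₁ (ih (Effective-⊏ (dual-effective mt)) (Effective-⊏ (partner-effective mt))
                      (Inverses-sym (partner-dual mt)))
        x≼ȳ = ≼-trans (dominates mt) (inverse-unique (partner-dual mt) (Inverses-sym y≡ȳ) o)
    return (inj₂ (inj₁ (keeps (conj-antitone (swap o) (below (dual-effective mt))) uZ
      (wins-move o (⊕-optionˡ (conj-option o (move (dual-effective mt)))) (nw ∘ blocks x≼ȳ uZ)))))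

  -- Induction on `Z`; the second half is the first with `G` and `H` exchanged, reflected by
  -- conjugation. The two implications between strengths settle the wins by having no move, where
  -- there is no option to match.
  inverse-≼-conj : Inverses G H → ConjInverses G H → Opponents s t →
    (Strong s t H → Strong t s G) → (Strong s t G → Strong t s H) → H ≼[ s , t ] conj G
  inverse-≼-conj {G} {H} {s} {t} inv ih o f g =
    le (λ u → proj₁ (go (≺-wellFounded _) u)) (λ u → proj₂ (go (≺-wellFounded _) u))
    where
    go : Acc _≺_ Z → 𝒰 Z → (Wins s (H ⊕ Z) → Wins s (conj G ⊕ Z)) × (Wins t (conj G ⊕ Z) → Wins t (H ⊕ Z))
    go {Z} (acc rec) uZ =
      (λ w → wins-stable (transfer inv ih o uZ (⊏-wellFounded H) ⊑-refl ≼-refl w >>= (return ∘ forth))) ,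
      (λ w → wins-stable (transfer (Inverses-sym inv) (ConjInverses-sym ih) o (conj-closed _ uZ)
               (⊏-wellFounded G) ⊑-refl ≼-refl (wins-reflect o w) >>= (return ∘ back)))
      where
      forth : Transfer s t G H Z → Wins s (conj G ⊕ Z)
      forth (inj₁ (_ , m , nw)) =
        wins-move o (⊕-optionʳ m) (nw ∘ proj₂ (go (rec (_ , m)) (option-closed uZ m)))
      forth (inj₂ (inj₁ w)) = w
      forth (inj₂ (inj₂ (e , st))) = strong-conj-wins o (f st) uZ e

      unconj : Wins s (conj H ⊕ conj Z) → Wins t (H ⊕ Z)
      unconj w = wins-conj⁻ o (wins-≅ (≅-sym (conj-⊕ H Z)) w)

      back : Transfer s t H G (conj Z) → Wins t (H ⊕ Z)
      back (inj₁ (_ , m , nw)) with conj-option⁻ o m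
      ... | _ , n , refl = wins-move (swap o) (⊕-optionʳ n)
              (nw ∘ wins-reflect (swap o) ∘ proj₁ (go (rec (_ , n)) (option-closed uZ n)))
      back (inj₂ (inj₁ w)) = unconj w
      back (inj₂ (inj₂ (e , st))) = unconj (strong-conj-wins o (g st) (conj-closed _ uZ) e)

  -- When `t` starts, `s` mirrors the moves in `G ⊕ conj G`, up to reversal and domination by
  -- invertible games. When `s` starts and cannot move in `Z`, strength of `G` for both players
  -- provides the win.
  strong-≽0 : Inverses G H → ConjInverses G H → Opponents s t →
    Strong s t G → Strong t s G → G ⊕ conj G ≼[ t , s ] 0G
  strong-≽0 {G} {H} {s} {t} inv ih o (E , uE , eE , E≼G) (F , uF , eF , F≼G) =
    le (λ u w → wins-stable λ nw →
          second (≺-wellFounded _) u (nw ∘ wins-≅ (≅-sym (⊕-identityˡ _)))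
            (⊏-wellFounded G) ⊑-refl ≼-refl (⊏-wellFounded G) ⊑-refl ≼-refl w)
       (λ u w → first (≺-wellFounded _) u (wins-≅ (⊕-identityˡ _) w))
    where
    uG = closedˡ inv

    raise : 𝒰 A → 𝒰 B → 𝒰 P → 𝒰 Q → P ≼[ s , t ] A → B ≼[ s , t ] Q → 𝒰 Z →
            Wins s ((P ⊕ conj Q) ⊕ Z) → Wins s ((A ⊕ conj B) ⊕ Z)
    raise uA uB uP uQ p q uZ =
      keeps (⊕-mono uA (conj-closed _ uB) p (flip (conj-antitone o q)) (conj-closed _ uQ)) uZ

    cancel : Inverses x (conj x) → ¬ Wins t Z → 𝒰 Z → ¬ Wins t ((x ⊕ conj x) ⊕ Z)
    cancel i nw uZ w = nw (wins-≅ (⊕-identityˡ _) (keeps (null i (swap o)) uZ w))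

    first : Acc _≺_ Z → 𝒰 Z → Wins s Z → Wins s ((G ⊕ conj G) ⊕ Z)
    -- `A` and `B` stand in for the two copies of `G` as reversals are played out; neither
    -- replacement harms `s`.
    second : Acc _≺_ Z → 𝒰 Z → ¬ Wins t Z →
             Acc _⊏_ A → A ⊑ G → A ≼[ t , s ] G → Acc _⊏_ B → B ⊑ G → B ≼[ s , t ] G →
             ¬ Wins t ((A ⊕ conj B) ⊕ Z)

    first {Z} (acc rec) uZ w with wins-move⁻ o w
    -- The copies of `G` are lowered to `E` and `conj F`, which leaves `s` without any move.
    ... | inj₁ e = raise uG uG uE uF E≼G (flip F≼G) uZ (wins-end (⊕-end (⊕-end eE (conj-end o eF)) e))
    ... | inj₂ (_ , m , nw) = wins-move o (⊕-optionʳ m)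
            (second (rec (_ , m)) (option-closed uZ m) nw
              (⊏-wellFounded G) ⊑-refl ≼-refl (⊏-wellFounded G) ⊑-refl ≼-refl)

    second {Z} {A} {B} (acc rec) uZ nw (acc recA) A⊑G A≽G (acc recB) B⊑G B≼G =
      -- Since `t` loses `Z`, there is a move in `Z`, so `t` does not win for want of moves.
      loses-move (swap o) (_ , ⊕-optionʳ (proj₂ (loses-nonEnd nw))) answer
      where
      uA = ⊑-closed uG A⊑G
      uB = ⊑-closed uG B⊑G

      answerˡ : A ⟶[ t ] y → Wins s ((y ⊕ conj B) ⊕ Z)
      answerˡ {y} m = wins-stable do
        no ny ← ¬¬-excluded-middle {A = Reversible t s G y}
          where yes (_ , n , q) → return (wins-move o (⊕-optionˡ (⊕-optionˡ n))
                  (second (acc rec) uZ nw (recA (≺-⊏ (_ , n) (_ , m)))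
                    (≺-⊑ (_ , n) (≺-⊑ (_ , m) A⊑G)) q (acc recB) B⊑G B≼G))
        mt ← match (Inverses-sym inv) (swap o) (effective A⊑G A≽G m) ny
        let e = partner-effective mt
            i = proj₁ (ih (Effective-⊏ e) (Effective-⊏ (dual-effective mt)) (partner-dual mt))
        -- `B` may lack the mirror move, so `conj B` is lowered to the conjugate of the source of
        -- `partner`, which has it; the resulting inverse pair cancels.
        return (raise (option-closed uA m) uB (closedˡ i) (⊑-closed uG (follower e))
                  (flip (dominates mt)) (≼-trans B≼G (flip (below e))) uZ
                  (wins-move o (⊕-optionˡ (⊕-optionʳ (conj-option o (move e)))) (cancel i nw uZ)))

      answerʳ : B ⟶[ s ] y → Wins s ((A ⊕ conj y) ⊕ Z)
      answerʳ {y} m = wins-stable do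
        no ny ← ¬¬-excluded-middle {A = Reversible s t G y}
          where yes (_ , n , q) → return (wins-move o (⊕-optionˡ (⊕-optionʳ (conj-option o n)))
                  (second (acc rec) uZ nw (acc recA) A⊑G A≽G (recB (≺-⊏ (_ , n) (_ , m)))
                    (≺-⊑ (_ , n) (≺-⊑ (_ , m) B⊑G)) q))
        mt ← match (Inverses-sym inv) o (effective B⊑G B≼G m) ny
        let e = partner-effective mt
            i = proj₁ (ih (Effective-⊏ e) (Effective-⊏ (dual-effective mt)) (partner-dual mt))
        return (raise uA (option-closed uB m) (⊑-closed uG (follower e)) (closedˡ i)
                  (≼-trans (below e) (flip A≽G)) (dominates mt) uZ
                  (wins-move o (⊕-optionˡ (⊕-optionˡ (move e))) (cancel i nw uZ)))

      answer : (A ⊕ conj B) ⊕ Z ⟶[ t ] z → Wins s z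
      answer m with ⊕-option⁻ m
      ... | inj₂ (_ , n , refl) =
        raise uA uB uG uG (flip A≽G) B≼G (option-closed uZ n)
          (first (rec (_ , n)) (option-closed uZ n) (loses-move⁻ (swap o) nw n))
      ... | inj₁ (_ , n , refl) with ⊕-option⁻ n
      ... | inj₁ (_ , k , refl) = answerˡ k
      ... | inj₂ (_ , k , refl) with conj-option⁻ (swap o) k
      ... | _ , l , refl = answerʳ l

  -- Case distinction on strength, and the final induction

  ≼0⇒conj-inverse : Opponents s t → 𝒰 G → G ⊕ conj G ≼[ s , t ] 0G → Inverses G (conj G)
  ≼0⇒conj-inverse o uG p = inverses o uG (conj-closed _ uG) p (conj-null o p)

  ≼-conj⇒conj-inverse : Inverses G H → Opponents s t → H ≼[ s , t ] conj G → Inverses G (conj G)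
  ≼-conj⇒conj-inverse inv o p = ≼0⇒conj-inverse (swap o) uG
    (≼-trans (≅⇒≼ (⊕-comm _ _)) (≼-trans (⊕-monoˡ uG (flip p)) (⊕-comm-≼0 (null inv (swap o)))))
    where uG = closedˡ inv

  ConjInverse-stable : 𝒰 G → ¬ ¬ Inverses G (conj G) → Inverses G (conj G)
  ConjInverse-stable uG m = ≼0⇒conj-inverse LR uG (≼-stable λ n → m λ i → n (null i LR))

  conj-inverse-step : Inverses G H → ConjInverses G H → ¬ ¬ Inverses G (conj G)
  conj-inverse-step {G} {H} inv ih = do
    gL ← ¬¬-excluded-middle {A = Strong Left Right G}
    gR ← ¬¬-excluded-middle {A = Strong Right Left G}
    hL ← ¬¬-excluded-middle {A = Strong Left Right H}
    hR ← ¬¬-excluded-middle {A = Strong Right Left H}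
    return (cases gL gR hL hR)
    where
    compare : Opponents s t → H ≼[ s , t ] conj G → Inverses G (conj G)
    compare = ≼-conj⇒conj-inverse inv

    cases : Dec (Strong Left Right G) → Dec (Strong Right Left G) →
            Dec (Strong Left Right H) → Dec (Strong Right Left H) → Inverses G (conj G)
    cases (yes gL) (yes gR) _ _ = ≼0⇒conj-inverse RL (closedˡ inv) (strong-≽0 inv ih LR gL gR)
    -- Here `H` is inverse to its conjugate, and this passes to its inverse `G`.
    cases _ _ (yes hL) (yes hR) =
      conj-inverse (Inverses-sym inv) (≼0⇒conj-inverse RL (closedʳ inv)
        (strong-≽0 (Inverses-sym inv) (ConjInverses-sym ih) LR hL hR))
    -- `H` is strong for exactly one player; taking `s` to be the other makes the first implication
    -- vacuous and the second true.
    cases _ _ (yes hL) (no ¬hR) =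
      compare RL (inverse-≼-conj inv ih RL (⊥-elim ∘ ¬hR) λ _ → hL)
    cases _ _ (no ¬hL) (yes hR) =
      compare LR (inverse-≼-conj inv ih LR (⊥-elim ∘ ¬hL) λ _ → hR)
    -- `H` is strong for neither player, so `s` is chosen such that `G` is not strong for `s`; both
    -- implications are vacuous.
    cases _ (no ¬gR) (no ¬hL) (no ¬hR) =
      compare RL (inverse-≼-conj inv ih RL (⊥-elim ∘ ¬hR) (⊥-elim ∘ ¬gR))
    cases (no ¬gL) _ (no ¬hL) (no ¬hR) =
      compare LR (inverse-≼-conj inv ih LR (⊥-elim ∘ ¬hL) (⊥-elim ∘ ¬gL))

  -- Recursion on `G` alone suffices: the result for a follower of `G` carries over to its inverse
  -- among the followers of `H` by `conj-inverse`.
  inverse⇒conj-inverse : Acc _⊏_ G → Inverses G H → Inverses G (conj G)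
  inverse⇒conj-inverse {G} {H} (acc rec) inv = ConjInverse-stable (closedˡ inv) (conj-inverse-step inv ih)
    where
    ih : ConjInverses G H
    ih p _ i = let j = inverse⇒conj-inverse (rec p) i in j , conj-inverse i j

  ≥⇒≼ : G ≥[ 𝒰 ] H → H ≼[ Left , Right ] G
  ≥⇒≼ p = le
    (λ { u (won e) → won (proj₁ (outcome-≥⁻ _ _ _ _ (p _ u)) e) })
    (λ { u (won e) → won (proj₂ (outcome-≥⁻ _ _ _ _ (p _ u)) e) })

  ≼⇒≥ : H ≼[ Left , Right ] G → G ≥[ 𝒰 ] H
  ≼⇒≥ p X u = outcome-≥ _ _ _ _ (Wins.winsFirst ∘ keeps p u ∘ won) (Wins.winsFirst ∘ blocks p u ∘ won)

theorem3p7 : {ℓ : Level} (𝒰 : GameSet ℓ) → IsUniverse 𝒰 → HasConjugateProperty 𝒰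
theorem3p7 𝒰 universe G uG (_ , H , uH , p , q) =
  uG , closedʳ inv , ≼⇒≥ (flip (null inv RL)) , ≼⇒≥ (null inv LR)
  where
  open Ordering 𝒰 universe
  open Inverses
  inv : Inverses G (conj G)
  inv = inverse⇒conj-inverse (⊏-wellFounded G) (inverses RL uG uH (flip (≥⇒≼ p)) (≥⇒≼ q))
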